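{- For every two integers $d,\ell \geq 2$, every graph $G$ with at least one vertex that is $\{S_d,K_{\ell,\ell}\}$-free has a vertex $v$ such that $\alpha(G[N[v]]) < d^2\ell + 2d\ell^{d-1}$.
   Context: Graphs are finite and simple. For $d\ge 2$, $S_d$ is the graph obtained from the star $K_{1,d}$ by subdividing each edge exactly once (so $S_2=P_5$). $K_{\ell,\ell}$ is the complete bipartite graph with parts of size $\ell$. A graph is $\mathcal{F}$-free if it has no induced subgraph isomorphic to a member of $\mathcal{F}$. $N[v]$ is the closed neighborhood of $v$ and $\alpha$ denotes the independence number. -}

module Defs where

open import Data.Nat using (ℕ; suc)
open import Data.Fin using (Fin)
open import Data.Bool using (Bool; true; false; _∧_; _∨_; not)
open import Data.Unit using (⊤; tt)
open import Data.Sum using (_⊎_; inj₁; inj₂)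
open import Data.Product using (Σ; _×_; ∃-syntax)
open import Data.List using (List; length)
open import Data.List.Membership.Propositional using (_∈_)
open import Data.List.Relation.Unary.Unique.Propositional using (Unique)
open import Relation.Binary.PropositionalEquality using (_≡_; _≢_)
open import Relation.Nullary using (¬_)
open import Function.Definitions using (Injective)
open import Data.Fin using (_≟_)
open import Relation.Nullary.Decidable using (⌊_⌋)

record Graph (V : Set) : Set where
  field
    adj   : V → V → Bool
    sym   : ∀ x y → adj x y ≡ adj y x
    irrefl : ∀ x → adj x x ≡ false
open Graph public

_InducedIn_ : ∀ {W V : Set} → Graph W → Graph V → Set
_InducedIn_ {W} {V} H G =
  Σ (W → V) λ f → Injective _≡_ _≡_ f × (∀ x y → adj H x y ≡ adj G (f x) (f y))

-- S_d: K_{1,d} with each edge subdivided once.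
-- Vertices: centre (inj₁ tt), middles (inj₂ (inj₁ i)), leaves (inj₂ (inj₂ i)).
SV : ℕ → Set
SV d = ⊤ ⊎ (Fin d ⊎ Fin d)

sAdj : ∀ {d} → SV d → SV d → Bool
sAdj (inj₁ _) (inj₁ _) = false
sAdj (inj₁ _) (inj₂ (inj₁ _)) = true
sAdj (inj₁ _) (inj₂ (inj₂ _)) = false
sAdj (inj₂ (inj₁ _)) (inj₁ _) = true
sAdj (inj₂ (inj₁ _)) (inj₂ (inj₁ _)) = false
sAdj (inj₂ (inj₁ i)) (inj₂ (inj₂ j)) = ⌊ i ≟ j ⌋
sAdj (inj₂ (inj₂ _)) (inj₁ _) = false
sAdj (inj₂ (inj₂ i)) (inj₂ (inj₁ j)) = ⌊ i ≟ j ⌋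
sAdj (inj₂ (inj₂ _)) (inj₂ (inj₂ _)) = false

sSym : ∀ {d} (x y : SV d) → sAdj x y ≡ sAdj y x
sSym (inj₁ _) (inj₁ _) = _≡_.refl
sSym (inj₁ _) (inj₂ (inj₁ _)) = _≡_.refl
sSym (inj₁ _) (inj₂ (inj₂ _)) = _≡_.refl
sSym (inj₂ (inj₁ _)) (inj₁ _) = _≡_.refl
sSym (inj₂ (inj₁ _)) (inj₂ (inj₁ _)) = _≡_.refl
sSym (inj₂ (inj₁ i)) (inj₂ (inj₂ j)) with i ≟ j | j ≟ i
... | Relation.Nullary.yes _ | Relation.Nullary.yes _ = _≡_.refl
... | Relation.Nullary.no _ | Relation.Nullary.no _ = _≡_.refl
... | Relation.Nullary.yes p | Relation.Nullary.no q = Data.Empty.⊥-elim (q (Relation.Binary.PropositionalEquality.sym p))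
  where import Data.Empty
... | Relation.Nullary.no q | Relation.Nullary.yes p = Data.Empty.⊥-elim (q (Relation.Binary.PropositionalEquality.sym p))
  where import Data.Empty
sSym (inj₂ (inj₂ _)) (inj₁ _) = _≡_.refl
sSym (inj₂ (inj₂ i)) (inj₂ (inj₁ j)) with i ≟ j | j ≟ i
... | Relation.Nullary.yes _ | Relation.Nullary.yes _ = _≡_.refl
... | Relation.Nullary.no _ | Relation.Nullary.no _ = _≡_.refl
... | Relation.Nullary.yes p | Relation.Nullary.no q = Data.Empty.⊥-elim (q (Relation.Binary.PropositionalEquality.sym p))
  where import Data.Empty
... | Relation.Nullary.no q | Relation.Nullary.yes p = Data.Empty.⊥-elim (q (Relation.Binary.PropositionalEquality.sym p))
  where import Data.Empty
sSym (inj₂ (inj₂ _)) (inj₂ (inj₂ _)) = _≡_.refl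

sIrr : ∀ {d} (x : SV d) → sAdj x x ≡ false
sIrr (inj₁ _) = _≡_.refl
sIrr (inj₂ (inj₁ _)) = _≡_.refl
sIrr (inj₂ (inj₂ _)) = _≡_.refl

S : (d : ℕ) → Graph (SV d)
S d = record { adj = sAdj ; sym = sSym ; irrefl = sIrr }

kAdj : ∀ {ℓ} → Fin ℓ ⊎ Fin ℓ → Fin ℓ ⊎ Fin ℓ → Bool
kAdj (inj₁ _) (inj₁ _) = false
kAdj (inj₁ _) (inj₂ _) = true
kAdj (inj₂ _) (inj₁ _) = true
kAdj (inj₂ _) (inj₂ _) = false

kSym : ∀ {ℓ} (x y : Fin ℓ ⊎ Fin ℓ) → kAdj x y ≡ kAdj y x
kSym (inj₁ _) (inj₁ _) = _≡_.refl
kSym (inj₁ _) (inj₂ _) = _≡_.refl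
kSym (inj₂ _) (inj₁ _) = _≡_.refl
kSym (inj₂ _) (inj₂ _) = _≡_.refl

kIrr : ∀ {ℓ} (x : Fin ℓ ⊎ Fin ℓ) → kAdj x x ≡ false
kIrr (inj₁ _) = _≡_.refl
kIrr (inj₂ _) = _≡_.refl

K : (ℓ : ℕ) → Graph (Fin ℓ ⊎ Fin ℓ)
K ℓ = record { adj = kAdj ; sym = kSym ; irrefl = kIrr }

InClosedNbhd : ∀ {V} → Graph V → V → V → Set
InClosedNbhd G v u = (u ≡ v) ⊎ (adj G v u ≡ true)

IndepInClosedNbhd : ∀ {V} → Graph V → V → List V → Set
IndepInClosedNbhd G v I =
  Unique I × (∀ {u} → u ∈ I → InClosedNbhd G v u)
           × (∀ {x y} → x ∈ I → y ∈ I → adj G x y ≡ false)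

αClosedNbhd< : ∀ {V} → Graph V → V → ℕ → Set
αClosedNbhd< G v k = ∀ I → IndepInClosedNbhd G v I → Data.Nat._<_ (length I) k
  where import Data.Nat

module Submission where

open import Defs renaming (sym to adj-sym)
open import Data.Bool using (Bool; true; false)
open import Data.Bool.Properties using (¬-not) renaming (_≟_ to _≟ᵇ_)
open import Data.Empty using (⊥)
open import Data.Fin using (Fin; zero; suc; inject≤; _≟_)
open import Data.Fin.Properties using (inject≤-injective) renaming (all? to allFin?)
open import Data.Fin.Subset using (Subset) renaming (_∈_ to _∈ˢ_; ⊥ to ∅)
open import Data.Fin.Subset.Properties using (anySubset?; ∉⊥) renaming (_∈?_ to _∈ˢ?_)
open import Data.List using (List; []; _∷_; _++_; length; filter; take; allFin; lookup)
open import Data.List.Properties using (length-filter; length-take; length-++; length-++-sucʳ; length-tabulate)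
open import Data.List.Membership.Propositional using (_∈_; _∉_; find; lose)
open import Data.List.Membership.Propositional.Properties
  using (∈-filter⁺; ∈-filter⁻; ∈-∃++; ∈-++⁻; ∈-++⁺ˡ; ∈-++⁺ʳ; ∈-allFin; ∈-lookup)
open import Data.List.Relation.Binary.Sublist.Propositional using (_⊆_; ⊆-refl; ⊆-trans)
  renaming (lookup to Any-resp-⊆)
open import Data.List.Relation.Binary.Sublist.Propositional.Properties
  using (length-mono-≤; filter-⊆; take-⊆) renaming (filter⁺ to ⊆-filter⁺)
open import Data.List.Relation.Unary.All as All using (All; []; _∷_; all?)
open import Data.List.Relation.Unary.All.Properties using (¬All⇒Any¬)
open import Data.List.Relation.Unary.AllPairs using ([]; _∷_)
open import Data.List.Relation.Unary.Any using (Any; here; there; any?)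
open import Data.List.Relation.Unary.Unique.Propositional using (Unique)
open import Data.List.Relation.Unary.Unique.Propositional.Properties using (allFin⁺)
  renaming (filter⁺ to Unique-filter⁺; take⁺ to Unique-take⁺; ++⁺ to Unique-++⁺)
open import Data.Nat using (ℕ; zero; suc; _+_; _*_; _∸_; _^_; _≤_; _<_; z≤n; s≤s; s≤s⁻¹; pred; _≤?_; _<?_; >-nonZero; NonZero)
open import Data.Nat.Properties hiding (_≟_; _≤?_; _<?_)
open import Data.Nat.Tactic.RingSolver using (solve-∀)
open import Data.Product using (Σ; ∃; ∃-syntax; _×_; _,_; proj₁; proj₂)
open import Data.Sum using (_⊎_; inj₁; inj₂)
open import Data.Unit using (tt)
open import Data.Vec using () renaming (tabulate to tabulateᵛ)
open import Data.Vec.Properties using (lookup∘tabulate; lookup⇒[]=; []=⇒lookup)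
open import Function using (flip; _∘_)
open import Level using (0ℓ)
open import Relation.Binary using (REL; Decidable)
open import Relation.Binary.PropositionalEquality using (_≡_; _≢_; refl; sym; trans; cong; subst)
open import Relation.Nullary using (¬_; Dec; yes; no; contradiction; does)
open import Relation.Nullary.Decidable using (¬?; _×-dec_; decidable-stable; dec-true; dec-false)
open import Relation.Unary using (Pred) renaming (Decidable to Decidable₁)
open import Relation.Unary.Properties using (∁?)

-- Let I be a maximum independent set of G and v ∈ I; every such v works. Let A be an
-- independent set in N(v) and consider the bipartite graph between A and I ∖ {v}. Since
-- replacing N(X) ∩ I by X cannot enlarge I, Hall's condition |X| ≤ |N(X) ∩ I| holds for
-- all X ⊆ A, and an induced matching of size d would give an S_d centred at v. A minimal
-- cover of a vertex set is an induced matching, so it has fewer than d elements; with Hall's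
-- condition this bounds the number of vertices of A of degree below dℓ by d²ℓ. On the
-- remaining vertices an induced matching is grown greedily: w₁, …, wᵢ are chosen together
-- with large sets P₁, …, Pᵢ of private neighbours, and K_{ℓ,ℓ}-freeness makes all but
-- fewer than ℓ vertices w keep a 1/ℓ fraction of each Pⱼ nonadjacent to w.

-- Counting in lists.

module _ {A : Set} {P : Pred A 0ℓ} (P? : Decidable₁ P) where

  length-partition : ∀ xs → length xs ≡ length (filter P? xs) + length (filter (∁? P?) xs)
  length-partition [] = refl
  length-partition (x ∷ xs) with P? x
  ... | yes _ = cong suc (length-partition xs)
  ... | no  _ = trans (cong suc (length-partition xs)) (sym (+-suc _ _))

  length-filter-filter : ∀ {Q : Pred A 0ℓ} (Q? : Decidable₁ Q) xs →
    length (filter P? (filter Q? xs)) ≤ length (filter P? xs)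
  length-filter-filter Q? xs =
    length-mono-≤ (⊆-filter⁺ P? P? (λ { refl p → p }) (filter-⊆ Q? xs))

Unique-⊆⇒length-≤ : ∀ {A : Set} {xs ys : List A} → Unique xs →
  (∀ {x} → x ∈ xs → x ∈ ys) → length xs ≤ length ys
Unique-⊆⇒length-≤ {xs = []} _ _ = z≤n
Unique-⊆⇒length-≤ {xs = x ∷ xs} (x∉xs ∷ uxs) xs⊆ys
  with as , bs , refl ← ∈-∃++ (xs⊆ys (here refl)) =
  subst (suc (length xs) ≤_) (sym (length-++-sucʳ as x bs))
    (s≤s (Unique-⊆⇒length-≤ uxs avoid))
  where
  avoid : ∀ {z} → z ∈ xs → z ∈ as ++ bs
  avoid z∈xs with ∈-++⁻ as (xs⊆ys (there z∈xs))
  ... | inj₁ z∈as = ∈-++⁺ˡ z∈as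
  ... | inj₂ (here refl) = contradiction refl (All.lookup x∉xs z∈xs)
  ... | inj₂ (there z∈bs) = ∈-++⁺ʳ as z∈bs

nonempty : ∀ {A : Set} (xs : List A) → 1 ≤ length xs → ∃ (_∈ xs)
nonempty (x ∷ _) _ = x , here refl

-- Induced matchings and irredundant covers.

record InducedMatching {A B : Set} (R : REL A B 0ℓ) (m : ℕ) : Set where
  field
    left    : Fin m → A
    right   : Fin m → B
    edge    : ∀ i → R (left i) (right i)
    nonedge : ∀ {i j} → i ≢ j → ¬ R (left i) (right j)
open InducedMatching

flip-matching : ∀ {A B : Set} {R : REL A B 0ℓ} {m} → InducedMatching (flip R) m → InducedMatching R m
flip-matching M = record
  { left = right M ; right = left M ; edge = edge M ; nonedge = λ i≢j → nonedge M (i≢j ∘ sym) }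

shrink-matching : ∀ {A B : Set} {R : REL A B 0ℓ} {m n} → m ≤ n → InducedMatching R n → InducedMatching R m
shrink-matching m≤n M = record
  { left = λ i → left M (inject≤ i m≤n)
  ; right = λ i → right M (inject≤ i m≤n)
  ; edge = λ i → edge M (inject≤ i m≤n)
  ; nonedge = λ i≢j → nonedge M (i≢j ∘ inject≤-injective m≤n m≤n _ _) }

matching-size-< : ∀ {A B : Set} {R : REL A B 0ℓ} {d m} →
  ¬ InducedMatching R d → InducedMatching R m → m < d
matching-size-< ¬M M = ≰⇒> λ d≤m → ¬M (shrink-matching d≤m M)

module _ {A B : Set} {R : REL A B 0ℓ} (R? : Decidable R) where

  -- An irredundant cover is an induced matching: y is kept only when some x₀
  -- is covered by y alone, and the rest of the cover handles xs ∖ N(y).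
  irredundant-cover : ∀ c ys xs →
    (∀ {x} → x ∈ xs → Any (R x) ys) →
    (∀ {y} → y ∈ ys → length (filter (λ x → R? x y) xs) ≤ c) →
    ∃ λ m → Σ (InducedMatching R m) λ M →
      (∀ i → left M i ∈ xs) × (∀ i → right M i ∈ ys) × length xs ≤ m * c
  irredundant-cover c [] [] _ _ =
    0 , record { left = λ () ; right = λ () ; edge = λ () ; nonedge = λ { {()} } }
      , (λ ()) , (λ ()) , z≤n
  irredundant-cover c [] (x ∷ xs) cov _ with () ← cov (here refl)
  irredundant-cover c (y ∷ ys) xs cov deg with all? (λ x → any? (R? x) ys) xs
  ... | yes all =
    let m , M , l∈ , r∈ , le = irredundant-cover c ys xs (All.lookup all) (deg ∘ there)
    in  m , M , l∈ , there ∘ r∈ , le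
  ... | no ¬all with x₀ , x₀∈ , ¬cov ← find (¬All⇒Any¬ (λ x → any? (R? x) ys) xs ¬all) =
    extend (irredundant-cover c ys rest rest-cov
             (λ y′∈ → ≤-trans (length-filter-filter (λ x → R? x _) (∁? Ry?) xs) (deg (there y′∈))))
    where
    Ry? : Decidable₁ (λ x → R x y)
    Ry? x = R? x y

    rest : List A
    rest = filter (∁? Ry?) xs

    rest-cov : ∀ {x} → x ∈ rest → Any (R x) ys
    rest-cov x∈ with x∈xs , ¬Rxy ← ∈-filter⁻ (∁? Ry?) x∈ with cov x∈xs
    ... | here Rxy = contradiction Rxy ¬Rxy
    ... | there a  = a

    x₀y : R x₀ y
    x₀y with cov x₀∈
    ... | here Rxy = Rxy
    ... | there a  = contradiction a ¬cov

    extend : (∃ λ m → Σ (InducedMatching R m) λ M →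
                (∀ i → left M i ∈ rest) × (∀ i → right M i ∈ ys) × length rest ≤ m * c) →
             ∃ λ m → Σ (InducedMatching R m) λ M →
                (∀ i → left M i ∈ xs) × (∀ i → right M i ∈ y ∷ ys) × length xs ≤ m * c
    extend (m , M , l∈ , r∈ , le) = suc m , M′
      , (λ { zero → x₀∈ ; (suc i) → proj₁ (∈-filter⁻ (∁? Ry?) {xs = xs} (l∈ i)) })
      , (λ { zero → here refl ; (suc i) → there (r∈ i) })
      , ≤-trans (≤-reflexive (length-partition Ry? xs)) (+-mono-≤ (deg (here refl)) le)
      where
      M′ : InducedMatching R (suc m)
      M′ .left zero = x₀
      M′ .left (suc i) = left M i
      M′ .right zero = y
      M′ .right (suc i) = right M i
      M′ .edge zero = x₀y
      M′ .edge (suc i) = edge M i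
      M′ .nonedge {zero} {zero} i≢j = contradiction refl i≢j
      -- No vertex of `ys` covers `x₀`, and all the other right ends come from `ys`.
      M′ .nonedge {zero} {suc j} _ r = ¬cov (lose (r∈ j) r)
      M′ .nonedge {suc i} {zero} _ = proj₂ (∈-filter⁻ (∁? Ry?) {xs = xs} (l∈ i))
      M′ .nonedge {suc i} {suc j} i≢j = nonedge M (i≢j ∘ cong suc)

-- Bicliques, and vertices that miss little of a set.

NoBiclique : ∀ {A B : Set} → REL A B 0ℓ → ℕ → Set
NoBiclique R ℓ = ∀ X Y → Unique X → Unique Y → (∀ {x y} → x ∈ X → y ∈ Y → R x y) →
  ℓ ≤ length X → ℓ ≤ length Y → ⊥

-- Discarding the at most `c` elements with `Q zero` leaves more than `m * c` of them for the
-- remaining `m` predicates.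
union-bound : ∀ {B : Set} {m} (Q : Fin m → Pred B 0ℓ) (Q? : ∀ j → Decidable₁ (Q j)) c (L : List B) →
  (∀ j → length (filter (Q? j) L) ≤ c) → m * c < length L → ∃ λ b → b ∈ L × ∀ j → ¬ Q j b
union-bound {m = zero} Q Q? c (b ∷ L) _ _ = b , here refl , λ ()
union-bound {m = suc m} Q Q? c L few lt
  with b , b∈ , good ← union-bound (Q ∘ suc) (Q? ∘ suc) c (filter (∁? (Q? zero)) L)
         (λ j → ≤-trans (length-filter-filter (Q? (suc j)) (∁? (Q? zero)) L) (few (suc j)))
         (+-cancelˡ-< c _ _ (<-≤-trans lt (≤-trans (≤-reflexive (length-partition (Q? zero) L))
           (+-monoˡ-≤ _ (few zero)))))
  with b∈L , ¬Q₀ ← ∈-filter⁻ (∁? (Q? zero)) b∈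
  = b , b∈L , λ { zero → ¬Q₀ ; (suc j) → good j }

module _ {A B : Set} {R : REL A B 0ℓ} (R? : Decidable R) (ℓ : ℕ) where

  neighbours nonneighbours : B → List A → List A
  neighbours b = filter (λ x → R? x b)
  nonneighbours b = filter (∁? (λ x → R? x b))

  -- b misses less than about a 1/ℓ fraction of P, so that ℓ heavy vertices have ℓ common
  -- neighbours in P; the successor is what supplies these ℓ.
  Heavy : List A → Pred B 0ℓ
  Heavy P b = ℓ * suc (length (nonneighbours b P)) ≤ length P

  heavy? : ∀ P → Decidable₁ (Heavy P)
  heavy? P b = _ ≤? _

  -- Each heavy vertex removes at most |P|/ℓ - 1 elements, so |X| ≥ |P| - |H| (|P|/ℓ - 1). The
  -- inequality is this one multiplied by ℓ and freed of subtraction.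
  common-neighbours : ∀ {P} H → Unique P → All (Heavy P) H →
    ∃ λ X → X ⊆ P × Unique X × (∀ {x b} → x ∈ X → b ∈ H → R x b) ×
      ℓ * (length P + length H) ≤ ℓ * length X + length H * length P
  common-neighbours {P} [] uP [] = P , ⊆-refl , uP , (λ _ ()) ,
    ≤-reflexive (trans (cong (ℓ *_) (+-identityʳ _)) (sym (+-identityʳ _)))
  common-neighbours {P} (h ∷ H) uP (heavy ∷ heavies)
    with X , X⊆P , uX , complete , le ← common-neighbours H uP heavies =
    neighbours h X , ⊆-trans (filter-⊆ _ X) X⊆P , Unique-filter⁺ _ uX
    , (λ { x∈ (here refl) → proj₂ (∈-filter⁻ (λ x → R? x h) {xs = X} x∈)
         ; x∈ (there b∈) → complete (proj₁ (∈-filter⁻ (λ x → R? x h) x∈)) b∈ })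
    , bound
    where
    p = length P
    k = length H
    a = length (neighbours h X)
    u = length (nonneighbours h X)
    v = length (nonneighbours h P)

    u≤v : u ≤ v
    u≤v = length-mono-≤ (⊆-filter⁺ _ _ (λ { refl r → r }) X⊆P)

    bound : ℓ * (p + suc k) ≤ ℓ * a + suc k * p
    bound = begin
      ℓ * (p + suc k)               ≡⟨ cong (ℓ *_) (+-suc p k) ⟩
      ℓ * suc (p + k)               ≡⟨ *-suc ℓ (p + k) ⟩
      ℓ + ℓ * (p + k)               ≤⟨ +-monoʳ-≤ ℓ le ⟩
      ℓ + (ℓ * length X + k * p)    ≡⟨ cong (λ x → ℓ + (ℓ * x + k * p)) (length-partition (λ x → R? x h) X) ⟩
      ℓ + (ℓ * (a + u) + k * p)     ≤⟨ +-monoʳ-≤ ℓ (+-monoˡ-≤ (k * p) (*-monoʳ-≤ ℓ (+-monoʳ-≤ a u≤v))) ⟩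
      ℓ + (ℓ * (a + v) + k * p)     ≡⟨ regroup ℓ a v (k * p) ⟩
      ℓ * a + (ℓ * suc v + k * p)   ≤⟨ +-monoʳ-≤ (ℓ * a) (+-monoˡ-≤ (k * p) heavy) ⟩
      ℓ * a + suc k * p             ∎
      where
      open ≤-Reasoning
      regroup : ∀ l a v q → l + (l * (a + v) + q) ≡ l * a + (l * suc v + q)
      regroup = solve-∀

  -- For exactly ℓ heavy vertices |P| cancels from the bound of `common-neighbours`, leaving |X| ≥ ℓ
  -- and hence a biclique. This is why the heavy vertices are cut down by `take ℓ`.
  few-heavy : 1 ≤ ℓ → NoBiclique R ℓ → ∀ {P ys} → Unique P → Unique ys → length (filter (heavy? P) ys) < ℓ
  few-heavy 1≤ℓ noK {P} {ys} uP uys = ≰⇒> many-impossible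
    where
    many-impossible : ¬ ℓ ≤ length (filter (heavy? P) ys)
    many-impossible ℓ≤ =
      let X , _ , uX , complete , le = common-neighbours H uP (All.tabulate (proj₂ ∘ ∈-filter⁻ (heavy? P) {xs = ys} ∘ H⊆))
      in  noK X H uX (Unique-take⁺ ℓ (Unique-filter⁺ (heavy? P) uys)) complete (large le) (≤-reflexive (sym |H|))
      where
      H = take ℓ (filter (heavy? P) ys)

      H⊆ : ∀ {b} → b ∈ H → b ∈ filter (heavy? P) ys
      H⊆ = Any-resp-⊆ (take-⊆ ℓ _)

      |H| : length H ≡ ℓ
      |H| = trans (length-take ℓ _) (m≤n⇒m⊓n≡m ℓ≤)

      large : ∀ {x} → ℓ * (length P + length H) ≤ ℓ * x + length H * length P → ℓ ≤ x
      large {x} le = +-cancelˡ-≤ (length P) _ _ (*-cancelˡ-≤ ℓ ⦃ >-nonZero 1≤ℓ ⦄ (begin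
        ℓ * (length P + ℓ)               ≡⟨ cong (λ k → ℓ * (length P + k)) |H| ⟨
        ℓ * (length P + length H)        ≤⟨ le ⟩
        ℓ * x + length H * length P      ≡⟨ cong (λ k → ℓ * x + k * length P) |H| ⟩
        ℓ * x + ℓ * length P             ≡⟨ *-distribˡ-+ ℓ x _ ⟨
        ℓ * (x + length P)               ≡⟨ cong (ℓ *_) (+-comm x _) ⟩
        ℓ * (length P + x)               ∎))
        where open ≤-Reasoning

-- Greedy growth of an induced matching, and the bipartite bound.

module _ {A B : Set} {R : REL A B 0ℓ} (R? : Decidable R) (d ℓ : ℕ) (1≤ℓ : 1 ≤ ℓ)
  (noK : NoBiclique R ℓ) (noM : ¬ InducedMatching R d) {ys : List B} (uys : Unique ys) where

  private instance
    ℓ≢0 : NonZero ℓ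
    ℓ≢0 = >-nonZero 1≤ℓ

  -- With r steps to go each private set must keep ℓ ^ r elements, and some chosen vertex
  -- sees more than a 1/d fraction of the rest; the rest is not needed after the last step.
  reserve : ℕ → ℕ
  reserve zero = 0
  reserve (suc r) = d * ℓ ^ r

  -- Here `i` vertices are chosen and `r` steps remain. Since `rest-degree` counts neighbours in all
  -- of `ys`, it survives every shrinking of `rest`.
  record Stage (r i : ℕ) : Set where
    field
      chosen    : Fin i → B
      private-of : Fin i → List A
      rest      : List A
      private-unique : ∀ j → Unique (private-of j)
      rest-unique    : Unique rest
      private-own    : ∀ j {x} → x ∈ private-of j → R x (chosen j)
      private-other  : ∀ {j j′ x} → j ≢ j′ → x ∈ private-of j → ¬ R x (chosen j′)
      rest-avoids    : ∀ j {x} → x ∈ rest → ¬ R x (chosen j)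
      rest-degree    : ∀ {x} → x ∈ rest → d * ℓ ≤ length (filter (R? x) ys)
      private-large  : ∀ j → ℓ ^ r ≤ length (private-of j)
      rest-large     : reserve r ≤ length rest

  -- Failure of `Heavy` means |P| < ℓ (1 + nonneighbours); comparing with ℓ t ≤ |P| and cancelling ℓ
  -- gives t < 1 + nonneighbours.
  light-large : ∀ P {b t} → ¬ Heavy R? ℓ P b → ℓ * t ≤ length P → t ≤ length (nonneighbours R? ℓ b P)
  light-large P ¬heavy le = s≤s⁻¹ (*-cancelˡ-< ℓ _ _ (≤-<-trans le (≰⇒> ¬heavy)))

  module _ {r i : ℕ} (eq : suc r + i ≡ d) (st : Stage (suc r) i) where
    open Stage st

    -- `rest` joins the private sets so that a single union bound treats them all.
    sets : Fin (suc i) → List A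
    sets zero = rest
    sets (suc j) = private-of j

    sets-unique : ∀ j → Unique (sets j)
    sets-unique zero = rest-unique
    sets-unique (suc j) = private-unique j

    Light : Pred B 0ℓ
    Light b = ∀ j → ¬ Heavy R? ℓ (sets j) b

    light? : Decidable₁ Light
    light? b = allFin? λ j → ¬? (heavy? R? ℓ (sets j) b)

    i<d : i < d
    i<d = ≤-trans (s≤s (m≤n+m i r)) (≤-reflexive eq)

    -- Each of the `suc i` ≤ d sets has at most ℓ - 1 heavy vertices in `ys`, too few in total to
    -- exhaust the d ℓ or more neighbours of `x`.
    light-cover : ∀ {x} → x ∈ rest → Any (R x) (filter light? ys)
    light-cover {x} x∈ =
      let b , b∈ , light = union-bound (λ j → Heavy R? ℓ (sets j)) (λ j → heavy? R? ℓ (sets j)) (pred ℓ)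
                             (filter (R? x) ys) few many
          b∈ys , Rxb = ∈-filter⁻ (R? x) {xs = ys} b∈
      in  lose (∈-filter⁺ light? b∈ys light) Rxb
      where
      few : ∀ j → length (filter (heavy? R? ℓ (sets j)) (filter (R? x) ys)) ≤ pred ℓ
      few j = ≤-trans (length-filter-filter (heavy? R? ℓ (sets j)) (R? x) ys)
        (<⇒≤pred (few-heavy R? ℓ 1≤ℓ noK (sets-unique j) uys))
      many : suc i * pred ℓ < length (filter (R? x) ys)
      many = begin-strict
        suc i * pred ℓ           <⟨ *-monoʳ-< (suc i) (≤-reflexive (suc-pred ℓ)) ⟩
        suc i * ℓ                ≤⟨ *-monoˡ-≤ ℓ i<d ⟩
        d * ℓ                    ≤⟨ rest-degree x∈ ⟩
        length (filter (R? x) ys) ∎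
        where open ≤-Reasoning

    big? : Decidable₁ (λ b → ℓ ^ r ≤ length (neighbours R? ℓ b rest))
    big? b = _ ≤? _

    -- Otherwise the light vertices cover `rest` with fewer than ℓ^r elements each. An irredundant
    -- subcover is an induced matching, so it has fewer than d members, and `rest` would have fewer
    -- than d ℓ^r elements. Decidability of `big?` lets `pick` remove the double negation.
    some-light-big : ¬ ¬ Any (λ b → ℓ ^ r ≤ length (neighbours R? ℓ b rest)) (filter light? ys)
    some-light-big ¬a =
      let m , M , _ , _ , le = irredundant-cover R? (pred (ℓ ^ r)) (filter light? ys) rest light-cover
                                 (λ b∈ → <⇒≤pred (≰⇒> λ le → ¬a (lose b∈ le)))
      in  <⇒≱ (begin-strict
          length rest      ≤⟨ le ⟩
          m * pred (ℓ ^ r) ≤⟨ *-monoʳ-≤ m pred[n]≤n ⟩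
          m * ℓ ^ r        <⟨ *-monoˡ-< (ℓ ^ r) ⦃ m^n≢0 ℓ r ⦄ (matching-size-< noM M) ⟩
          d * ℓ ^ r        ∎) rest-large
      where open ≤-Reasoning

    pick : ∃ λ b → Light b × ℓ ^ r ≤ length (neighbours R? ℓ b rest)
    pick =
      let b , b∈ , le = find (decidable-stable (any? big? (filter light? ys)) some-light-big)
      in  b , proj₂ (∈-filter⁻ light? {xs = ys} b∈) , le

    -- The neighbours of `b` in `rest` become its private set, as no earlier chosen vertex sees
    -- them. The other sets keep only their nonneighbours of `b`, about a 1/ℓ fraction or more
    -- because `b` is light.
    advance : Stage r (suc i)
    advance = record
      { chosen = λ { zero → b ; (suc j) → chosen j }
      ; private-of = λ { zero → neighbours R? ℓ b rest ; (suc j) → nonneighbours R? ℓ b (private-of j) }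
      ; rest = nonneighbours R? ℓ b rest
      ; private-unique = λ { zero → Unique-filter⁺ _ rest-unique ; (suc j) → Unique-filter⁺ _ (private-unique j) }
      ; rest-unique = Unique-filter⁺ _ rest-unique
      ; private-own = λ { zero x∈ → proj₂ (near rest x∈) ; (suc j) x∈ → private-own j (proj₁ (far (private-of j) x∈)) }
      ; private-other = λ
          { {zero} {zero} j≢j _ → contradiction refl j≢j
          ; {zero} {suc j′} _ x∈ → rest-avoids j′ (proj₁ (near rest x∈))
          ; {suc j} {zero} _ x∈ → proj₂ (far (private-of j) x∈)
          ; {suc j} {suc j′} j≢j′ x∈ → private-other (j≢j′ ∘ cong suc) (proj₁ (far (private-of j) x∈)) }
      ; rest-avoids = λ { zero x∈ → proj₂ (far rest x∈) ; (suc j) x∈ → rest-avoids j (proj₁ (far rest x∈)) }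
      ; rest-degree = λ x∈ → rest-degree (proj₁ (far rest x∈))
      ; private-large = λ { zero → le ; (suc j) → light-large (private-of j) (light (suc j)) (private-large j) }
      ; rest-large = still-large r rest-large (light zero)
      }
      where
      b = proj₁ pick
      light = proj₁ (proj₂ pick)
      le = proj₂ (proj₂ pick)
      near : ∀ {b x} P → x ∈ neighbours R? ℓ b P → x ∈ P × R x b
      near {b} P = ∈-filter⁻ (λ x → R? x b) {xs = P}
      far : ∀ {b x} P → x ∈ nonneighbours R? ℓ b P → x ∈ P × ¬ R x b
      far {b} P = ∈-filter⁻ (∁? (λ x → R? x b)) {xs = P}
      still-large : ∀ {b} r → reserve (suc r) ≤ length rest → ¬ Heavy R? ℓ rest b →
        reserve r ≤ length (nonneighbours R? ℓ b rest)
      still-large zero _ _ = z≤n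
      still-large (suc r) le ¬heavy = light-large rest ¬heavy (≤-trans (≤-reflexive swap) le)
        where
        swap : ℓ * (d * ℓ ^ r) ≡ d * (ℓ * ℓ ^ r)
        swap = trans (sym (*-assoc ℓ d _)) (trans (cong (_* ℓ ^ r) (*-comm ℓ d)) (*-assoc d ℓ _))

  -- With no step left there are d chosen vertices, each with at least ℓ^0 = 1 private neighbour;
  -- one from each gives the forbidden matching.
  no-stage : ∀ r {i} → r + i ≡ d → ¬ Stage r i
  no-stage (suc r) {i} eq st = no-stage r (trans (+-suc r i) eq) (advance eq st)
  no-stage zero refl st = noM record
    { left = λ j → proj₁ (witness j)
    ; right = chosen
    ; edge = λ j → private-own j (proj₂ (witness j))
    ; nonedge = λ {j} j≢j′ → private-other j≢j′ (proj₂ (witness j)) }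
    where
    open Stage st
    witness : ∀ j → ∃ (_∈ private-of j)
    witness j = nonempty (private-of j) (private-large j)

  -- The process starts with nothing chosen and with `X` as `rest`, where the only size demanded is
  -- `reserve d`, that is d ℓ^(d-1).
  high-degree-bound : ∀ {e} → suc e ≡ d → ∀ {X} → Unique X →
    (∀ {x} → x ∈ X → d * ℓ ≤ length (filter (R? x) ys)) → length X < d * ℓ ^ e
  high-degree-bound {e} eq {X} uX deg = ≰⇒> λ large → no-stage d (+-identityʳ d) (start large)
    where
    start : d * ℓ ^ e ≤ length X → Stage d 0
    start large = record
      { chosen = λ () ; private-of = λ () ; rest = X ; private-unique = λ () ; rest-unique = uX
      ; private-own = λ () ; private-other = λ { {()} } ; rest-avoids = λ () ; rest-degree = deg
      ; private-large = λ ()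
      ; rest-large = subst (λ k → reserve k ≤ length X) eq large }

  -- The relation is turned around: `X` covers its neighbours in `ys`, each member at most d ℓ - 1
  -- of them, and an irredundant cover has fewer than d members.
  low-degree-cover-bound : ∀ X → (∀ {x} → x ∈ X → length (filter (R? x) ys) < d * ℓ) →
    length (filter (λ b → any? (λ a → R? a b) X) ys) ≤ d * pred (d * ℓ)
  low-degree-cover-bound X low
    with m , M , _ , _ , le ← irredundant-cover (flip R?) (pred (d * ℓ)) X
           (filter (λ b → any? (λ a → R? a b) X) ys)
           (λ b∈ → proj₂ (∈-filter⁻ (λ b → any? (λ a → R? a b) X) {xs = ys} b∈))
           (λ {x} x∈ → ≤-trans (length-filter-filter (R? x) (λ b → any? (λ a → R? a b) X) ys)
              (<⇒≤pred (low x∈)))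
    = ≤-trans le (*-monoˡ-≤ _ (<⇒≤ (matching-size-< noM (flip-matching M))))

  -- The `suc` in the Hall hypothesis makes room for the centre of the spider, which belongs to the
  -- maximum independent set but not to `ys`.
  bipartite-bound : ∀ {e} → suc e ≡ d → ∀ {X₀} → Unique X₀ →
    (∀ X → Unique X → (∀ {x} → x ∈ X → x ∈ X₀) →
       length X ≤ suc (length (filter (λ b → any? (λ a → R? a b) X) ys))) →
    length X₀ < d * d * ℓ + d * ℓ ^ e
  bipartite-bound {e} refl {X₀} uX₀ hall = begin-strict
    length X₀                          ≡⟨ length-partition low? X₀ ⟩
    length low + length high           <⟨ +-mono-≤-< low-bound high-bound ⟩
    d * d * ℓ + d * ℓ ^ e              ∎
    where
    open ≤-Reasoning
    low? : Decidable₁ (λ x → length (filter (R? x) ys) < d * ℓ)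
    low? x = _ <? _
    low high : List A
    low = filter low? X₀
    high = filter (∁? low?) X₀

    high-bound : length high < d * ℓ ^ e
    high-bound = high-degree-bound refl (Unique-filter⁺ _ uX₀)
      (λ x∈ → ≮⇒≥ (proj₂ (∈-filter⁻ (∁? low?) {xs = X₀} x∈)))

    low-bound : length low ≤ d * d * ℓ
    low-bound = begin
      length low ≤⟨ hall low (Unique-filter⁺ _ uX₀) (proj₁ ∘ ∈-filter⁻ low? {xs = X₀}) ⟩
      suc _      ≤⟨ s≤s (low-degree-cover-bound low (proj₂ ∘ ∈-filter⁻ low? {xs = X₀})) ⟩
      -- The 1 from Hall's condition is at most d, and d is what raises d (d ℓ - 1) to d (d ℓ).
      suc (d * pred (d * ℓ))   ≤⟨ s≤s (m≤n+m _ e) ⟩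
      d + d * pred (d * ℓ)     ≡⟨ *-suc d _ ⟨
      d * suc (pred (d * ℓ))   ≡⟨ cong (d *_) (suc-pred (d * ℓ) ⦃ m*n≢0 d ℓ ⦄) ⟩
      d * (d * ℓ)              ≡⟨ *-assoc d d ℓ ⟨
      d * d * ℓ                ∎

-- Largest subsets of a finite set.

module _ {N : ℕ} where

  open import Data.List.Membership.DecPropositional (_≟_ {N}) using (_∈?_)

  members : Subset N → List (Fin N)
  members s = filter (_∈ˢ? s) (allFin N)

  toSubset : List (Fin N) → Subset N
  toSubset J = tabulateᵛ λ x → does (x ∈? J)

  ∈-toSubset⁺ : ∀ {J x} → x ∈ J → x ∈ˢ toSubset J
  ∈-toSubset⁺ {J} {x} x∈ = lookup⇒[]= x (toSubset J) (trans (lookup∘tabulate _ x) (dec-true (x ∈? J) x∈))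

  ∈-toSubset⁻ : ∀ {J x} → x ∈ˢ toSubset J → x ∈ J
  ∈-toSubset⁻ {J} {x} x∈ = decidable-stable (x ∈? J) λ x∉ →
    contradiction (trans (sym ([]=⇒lookup x∈)) (trans (lookup∘tabulate _ x) (dec-false (x ∈? J) x∉))) λ ()

  length-members : ∀ s → length (members s) ≤ N
  length-members s = ≤-trans (length-filter (_∈ˢ? s) (allFin N)) (≤-reflexive (length-tabulate _))

  -- The current subset is replaced by a larger one while there is any. `fuel` plus its size stays
  -- at least `N`, so once the fuel is spent no subset can be larger.
  largest-subset : ∀ {P : Pred (Subset N) 0ℓ} → Decidable₁ P → ∃ P →
    ∃ λ s → P s × ∀ t → P t → length (members t) ≤ length (members s)
  largest-subset {P} P? (s₀ , p₀) = search N s₀ p₀ (m≤m+n N _)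
    where
    search : ∀ fuel s → P s → N ≤ fuel + length (members s) →
      ∃ λ s → P s × ∀ t → P t → length (members t) ≤ length (members s)
    search zero s p N≤ = s , p , λ t _ → ≤-trans (length-members t) N≤
    search (suc fuel) s p N≤
      with anySubset? (λ t → P? t ×-dec (length (members s) <? length (members t)))
    ... | yes (t , q , s<t) = search fuel t q
            (≤-trans N≤ (≤-trans (≤-reflexive (sym (+-suc fuel _))) (+-monoʳ-≤ fuel s<t)))
    ... | no ¬larger = s , p , λ t q → ≮⇒≥ λ s<t → ¬larger (t , q , s<t)

-- Independent sets and induced subgraphs.

lookup-injective : ∀ {A : Set} {xs : List A} → Unique xs → ∀ {i j} → lookup xs i ≡ lookup xs j → i ≡ j
lookup-injective (_ ∷ _) {zero} {zero} _ = refl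
lookup-injective (x∉ ∷ _) {zero} {suc j} eq = contradiction eq (All.lookup x∉ (∈-lookup j))
lookup-injective (x∉ ∷ _) {suc i} {zero} eq = contradiction (sym eq) (All.lookup x∉ (∈-lookup i))
lookup-injective (_ ∷ u) {suc i} {suc j} eq = cong suc (lookup-injective u eq)

module _ {N : ℕ} (G : Graph (Fin N)) where

  Independent : List (Fin N) → Set
  Independent J = ∀ {x y} → x ∈ J → y ∈ J → adj G x y ≡ false

  adj? : ∀ x y → Dec (adj G x y ≡ true)
  adj? x y = adj G x y ≟ᵇ true

  true≢false : ∀ {b : Bool} → b ≡ true → b ≢ false
  true≢false refl ()

  -- The search runs over subsets, where it is decidable; a duplicate-free list `J` is compared with
  -- the result through `toSubset J`.
  maximum-independent : ∃ λ I → Unique I × Independent I ×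
    (∀ J → Unique J → Independent J → length J ≤ length I)
  maximum-independent =
    let s , p , largest = largest-subset (λ s → all? (λ x → all? (λ y → adj G x y ≟ᵇ false) (members s)) (members s))
                            (∅ , All.tabulate λ x∈ → contradiction (proj₂ (∈-filter⁻ (_∈ˢ? ∅) {xs = allFin N} x∈)) ∉⊥)
    in  members s , Unique-filter⁺ (_∈ˢ? s) (allFin⁺ N) , (λ x∈ y∈ → All.lookup (All.lookup p x∈) y∈)
      , λ J uJ indJ → ≤-trans (Unique-⊆⇒length-≤ uJ λ {x} x∈ → ∈-filter⁺ (_∈ˢ? toSubset J) (∈-allFin x) (∈-toSubset⁺ x∈))
          (largest (toSubset J) (All.tabulate λ x∈ → All.tabulate λ y∈ → indJ (back J x∈) (back J y∈)))
    where
    back : ∀ J {x} → x ∈ members (toSubset J) → x ∈ J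
    back J x∈ = ∈-toSubset⁻ (proj₂ (∈-filter⁻ (_∈ˢ? toSubset J) {xs = allFin N} x∈))

  touches? : ∀ X → Decidable₁ (λ b → Any (λ a → adj G a b ≡ true) X)
  touches? X b = any? (λ a → adj? a b) X

  -- `X` together with the members of `I` that it does not touch is independent, hence no longer
  -- than `I`; cancelling the kept members leaves Hall's condition.
  exchange : ∀ {I X} → Unique I → Independent I →
    (∀ J → Unique J → Independent J → length J ≤ length I) →
    Unique X → Independent X → (∀ {x} → x ∈ X → x ∉ I) →
    length X ≤ length (filter (touches? X) I)
  exchange {I} {X} uI indI max uX indX disj =
    +-cancelʳ-≤ (length kept) _ _ (begin
      length X + length kept    ≡⟨ length-++ X ⟨
      length (X ++ kept)        ≤⟨ max (X ++ kept) unique independent ⟩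
      length I                  ≡⟨ length-partition (touches? X) I ⟩
      length (filter (touches? X) I) + length kept ∎)
    where
    open ≤-Reasoning
    kept : List (Fin N)
    kept = filter (∁? (touches? X)) I

    kept⁻ : ∀ {x} → x ∈ kept → x ∈ I × ¬ Any (λ a → adj G a x ≡ true) X
    kept⁻ = ∈-filter⁻ (∁? (touches? X)) {xs = I}

    unique : Unique (X ++ kept)
    unique = Unique-++⁺ uX (Unique-filter⁺ _ uI) λ { (x∈X , x∈kept) → disj x∈X (proj₁ (kept⁻ x∈kept)) }

    cross : ∀ {x y} → x ∈ X → y ∈ kept → adj G x y ≡ false
    cross x∈ y∈ = ¬-not λ xy → proj₂ (kept⁻ y∈) (lose x∈ xy)

    independent : Independent (X ++ kept)
    independent x∈ y∈ with ∈-++⁻ X x∈ | ∈-++⁻ X y∈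
    ... | inj₁ x∈X | inj₁ y∈X = indX x∈X y∈X
    ... | inj₁ x∈X | inj₂ y∈K = cross x∈X y∈K
    ... | inj₂ x∈K | inj₁ y∈X = trans (adj-sym G _ _) (cross y∈X x∈K)
    ... | inj₂ x∈K | inj₂ y∈K = indI (proj₁ (kept⁻ x∈K)) (proj₁ (kept⁻ y∈K))

  biclique-embeds : ∀ {ℓ X Y} → Unique X → Unique Y → Independent X → Independent Y →
    (∀ {x y} → x ∈ X → y ∈ Y → adj G x y ≡ true) → ℓ ≤ length X → ℓ ≤ length Y → K ℓ InducedIn G
  biclique-embeds {ℓ} {X} {Y} uX uY indX indY complete ℓ≤X ℓ≤Y = f , injective , preserves
    where
    f : Fin ℓ ⊎ Fin ℓ → Fin N
    f (inj₁ i) = lookup X (inject≤ i ℓ≤X)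
    f (inj₂ j) = lookup Y (inject≤ j ℓ≤Y)

    preserves : ∀ x y → kAdj x y ≡ adj G (f x) (f y)
    preserves (inj₁ i) (inj₁ j) = sym (indX (∈-lookup (inject≤ i ℓ≤X)) (∈-lookup (inject≤ j ℓ≤X)))
    preserves (inj₁ i) (inj₂ j) = sym (complete (∈-lookup (inject≤ i ℓ≤X)) (∈-lookup (inject≤ j ℓ≤Y)))
    preserves (inj₂ i) (inj₁ j) = trans (preserves (inj₁ j) (inj₂ i)) (adj-sym G _ _)
    preserves (inj₂ i) (inj₂ j) = sym (indY (∈-lookup (inject≤ i ℓ≤Y)) (∈-lookup (inject≤ j ℓ≤Y)))

    -- Adjacent vertices have adjacent images, and no vertex is adjacent to itself; this separates
    -- the two sides.
    loop : ∀ {x y} → f x ≡ f y → kAdj x y ≢ true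
    loop {x} {y} eq xy = true≢false (trans (sym (preserves x y)) xy)
      (trans (cong (adj G (f x)) (sym eq)) (irrefl G (f x)))

    injective : ∀ {x y} → f x ≡ f y → x ≡ y
    injective {inj₁ i} {inj₁ j} eq = cong inj₁ (inject≤-injective ℓ≤X ℓ≤X i j (lookup-injective uX eq))
    injective {inj₁ i} {inj₂ j} eq = contradiction refl (loop {inj₁ i} {inj₂ j} eq)
    injective {inj₂ i} {inj₁ j} eq = contradiction refl (loop {inj₂ i} {inj₁ j} eq)
    injective {inj₂ i} {inj₂ j} eq = cong inj₂ (inject≤-injective ℓ≤Y ℓ≤Y i j (lookup-injective uY eq))

  module _ {d : ℕ} (v : Fin N) (M : InducedMatching (λ x y → adj G x y ≡ true) d)
    (v-left : ∀ i → adj G v (left M i) ≡ true) (v-right : ∀ i → adj G v (right M i) ≡ false)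
    (left-left : ∀ i j → adj G (left M i) (left M j) ≡ false)
    (right-right : ∀ i j → adj G (right M i) (right M j) ≡ false)
    (right≢v : ∀ i → right M i ≢ v) where

    spider : SV d → Fin N
    spider (inj₁ _) = v
    spider (inj₂ (inj₁ i)) = left M i
    spider (inj₂ (inj₂ i)) = right M i

    spider-preserves : ∀ x y → sAdj x y ≡ adj G (spider x) (spider y)
    spider-preserves (inj₁ _) (inj₁ _) = sym (irrefl G v)
    spider-preserves (inj₁ _) (inj₂ (inj₁ i)) = sym (v-left i)
    spider-preserves (inj₁ _) (inj₂ (inj₂ i)) = sym (v-right i)
    spider-preserves (inj₂ (inj₁ i)) (inj₁ _) = sym (trans (adj-sym G _ _) (v-left i))
    spider-preserves (inj₂ (inj₁ i)) (inj₂ (inj₁ j)) = sym (left-left i j)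
    spider-preserves (inj₂ (inj₁ i)) (inj₂ (inj₂ j)) with i ≟ j
    ... | yes refl = sym (edge M i)
    ... | no i≢j = sym (¬-not (nonedge M i≢j))
    spider-preserves (inj₂ (inj₂ i)) (inj₁ _) = sym (trans (adj-sym G _ _) (v-right i))
    spider-preserves (inj₂ (inj₂ i)) (inj₂ (inj₁ j)) =
      trans (sSym (inj₂ (inj₂ i)) (inj₂ (inj₁ j))) (trans (spider-preserves (inj₂ (inj₁ j)) (inj₂ (inj₂ i))) (adj-sym G _ _))
    spider-preserves (inj₂ (inj₂ i)) (inj₂ (inj₂ j)) = sym (right-right i j)

    spider-injective : ∀ {x y} → spider x ≡ spider y → x ≡ y
    spider-injective {inj₁ _} {inj₁ _} _ = refl
    spider-injective {inj₁ _} {inj₂ (inj₁ i)} eq =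
      contradiction (trans (cong (adj G v) eq) (v-left i)) (λ t → true≢false t (irrefl G v))
    spider-injective {inj₁ _} {inj₂ (inj₂ i)} eq = contradiction (sym eq) (right≢v i)
    spider-injective {inj₂ (inj₁ i)} {inj₁ _} eq = sym (spider-injective {inj₁ tt} (sym eq))
    spider-injective {inj₂ (inj₁ i)} {inj₂ (inj₁ j)} eq with i ≟ j
    ... | yes refl = refl
    -- If the left ends agreed, `left M i` would be adjacent to `right M j`.
    ... | no i≢j = contradiction (trans (cong (λ z → adj G z (right M j)) eq) (edge M j)) (nonedge M i≢j)
    spider-injective {inj₂ (inj₁ i)} {inj₂ (inj₂ j)} eq =
      contradiction (v-right j) (true≢false (trans (cong (adj G v) (sym eq)) (v-left i)))
    spider-injective {inj₂ (inj₂ i)} {inj₁ _} eq = contradiction eq (right≢v i)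
    spider-injective {inj₂ (inj₂ i)} {inj₂ (inj₁ j)} eq =
      contradiction (v-right i) (true≢false (trans (cong (adj G v) eq) (v-left j)))
    spider-injective {inj₂ (inj₂ i)} {inj₂ (inj₂ j)} eq with i ≟ j
    ... | yes refl = refl
    ... | no i≢j = contradiction (trans (cong (adj G (left M i)) (sym eq)) (edge M i)) (nonedge M i≢j)

    spider-embeds : S d InducedIn G
    spider-embeds = spider , spider-injective , spider-preserves

  -- The neighbourhood of a vertex of a maximum independent set.

  module _ {d ℓ e : ℕ} (d≡1+e : suc e ≡ d) (1≤ℓ : 1 ≤ ℓ)
    (noS : ¬ (S d InducedIn G)) (noK : ¬ (K ℓ InducedIn G))
    {I : List (Fin N)} (uI : Unique I) (indI : Independent I)
    (max : ∀ J → Unique J → Independent J → length J ≤ length I)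
    {v : Fin N} (v∈I : v ∈ I) where

    open import Data.List.Membership.DecPropositional (_≟_ {N}) using (_∈?_)

    -- `v` cannot be a leaf of a spider centred at itself; leaving it out costs 1 in Hall's
    -- condition.
    others : List (Fin N)
    others = filter (∁? (_≟ v)) I

    others⁻ : ∀ {x} → x ∈ others → x ∈ I × x ≢ v
    others⁻ = ∈-filter⁻ (∁? (_≟ v)) {xs = I}

    neighbourhood-bound : ∀ {A} → Unique A → Independent A → (∀ {x} → x ∈ A → adj G v x ≡ true) →
      length A < d * d * ℓ + d * ℓ ^ e
    neighbourhood-bound {A} uA indA v-A =
      bipartite-bound R? d ℓ 1≤ℓ no-biclique no-matching (Unique-filter⁺ _ uI) d≡1+e uA hall
      where
      -- Membership is built into the relation, so every edge of a matching or biclique runs between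
      -- `A` and `others`.
      R : REL (Fin N) (Fin N) 0ℓ
      R a b = (a ∈ A × b ∈ others) × adj G a b ≡ true

      R? : Decidable R
      R? a b = ((a ∈? A) ×-dec (b ∈? others)) ×-dec adj? a b

      no-biclique : NoBiclique R ℓ
      no-biclique X Y uX uY complete ℓ≤X ℓ≤Y = noK (biclique-embeds uX uY
        (λ x∈ y∈ → indA (X⊆A x∈) (X⊆A y∈)) (λ x∈ y∈ → indI (Y⊆I x∈) (Y⊆I y∈))
        (λ x∈ y∈ → proj₂ (complete x∈ y∈)) ℓ≤X ℓ≤Y)
        where
        X⊆A : ∀ {x} → x ∈ X → x ∈ A
        -- Membership in `A` is read off an edge to some element of `Y`, which exists as ℓ ≥ 1.
        X⊆A x∈ = proj₁ (proj₁ (complete x∈ (proj₂ (nonempty Y (≤-trans 1≤ℓ ℓ≤Y)))))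
        Y⊆I : ∀ {y} → y ∈ Y → y ∈ I
        Y⊆I y∈ = proj₁ (others⁻ (proj₂ (proj₁ (complete (proj₂ (nonempty X (≤-trans 1≤ℓ ℓ≤X))) y∈))))

      no-matching : ¬ InducedMatching R d
      no-matching M = noS (spider-embeds v
        (record { left = left M ; right = right M ; edge = λ i → proj₂ (edge M i)
                ; nonedge = λ {i} {j} i≢j xy → nonedge M i≢j ((left∈ i , right∈ j) , xy) })
        (λ i → v-A (left∈ i))
        (λ i → indI v∈I (proj₁ (others⁻ (right∈ i))))
        (λ i j → indA (left∈ i) (left∈ j))
        (λ i j → indI (proj₁ (others⁻ (right∈ i))) (proj₁ (others⁻ (right∈ j))))
        (λ i → proj₂ (others⁻ (right∈ i))))
        where
        left∈ : ∀ i → left M i ∈ A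
        left∈ i = proj₁ (proj₁ (edge M i))
        right∈ : ∀ i → right M i ∈ others
        right∈ i = proj₂ (proj₁ (edge M i))

      hall : ∀ X → Unique X → (∀ {x} → x ∈ X → x ∈ A) →
        length X ≤ suc (length (filter (λ b → any? (λ a → R? a b) X) others))
      hall X uX X⊆A = ≤-trans
        (exchange uI indI max uX (λ x∈ y∈ → indA (X⊆A x∈) (X⊆A y∈))
          (λ x∈X x∈I → true≢false (v-A (X⊆A x∈X)) (indI v∈I x∈I)))
        -- Of the members of `I` touched by `X`, only `v` can lie outside `others`; it accounts for
        -- the `suc`.
        (Unique-⊆⇒length-≤ {ys = v ∷ _} (Unique-filter⁺ (touches? X) uI) split)
        where
        split : ∀ {b} → b ∈ filter (touches? X) I → b ∈ v ∷ filter (λ b → any? (λ a → R? a b) X) others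
        split {b} b∈ with b ≟ v
        ... | yes b≡v = here b≡v
        ... | no b≢v =
          let b∈I , touched = ∈-filter⁻ (touches? X) {xs = I} b∈
              a , a∈ , ab = find touched
              b∈others = ∈-filter⁺ (∁? (_≟ v)) b∈I b≢v
          in  there (∈-filter⁺ (λ b → any? (λ a → R? a b) X) b∈others (lose a∈ ((X⊆A a∈ , b∈others) , ab)))

    -- An independent set containing `v` within the closed neighbourhood is just the singleton, and
    -- the bound is at least 2; any other lies in the open neighbourhood.
    closed-neighbourhood-bound : αClosedNbhd< G v (d * d * ℓ + d * ℓ ^ e)
    closed-neighbourhood-bound A (uA , A⊆ , indA) with v ∈? A
    ... | no v∉A = neighbourhood-bound uA indA adjacent
      where
      adjacent : ∀ {x} → x ∈ A → adj G v x ≡ true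
      adjacent x∈ with A⊆ x∈
      ... | inj₁ refl = contradiction x∈ v∉A
      ... | inj₂ vx = vx
    ... | yes v∈A = ≤-<-trans (Unique-⊆⇒length-≤ {ys = v ∷ []} uA (here ∘ only-v)) (bound-≥2 d≡1+e)
      where
      bound-≥2 : suc e ≡ d → 2 ≤ d * d * ℓ + d * ℓ ^ e
      bound-≥2 refl = +-mono-≤ (*-mono-≤ (*-mono-≤ 1≤d 1≤d) 1≤ℓ) (*-mono-≤ 1≤d (m^n>0 ℓ ⦃ >-nonZero 1≤ℓ ⦄ e))
        where
        1≤d : 1 ≤ suc e
        1≤d = s≤s z≤n

      only-v : ∀ {x} → x ∈ A → x ≡ v
      only-v x∈ with A⊆ x∈
      ... | inj₁ x≡v = x≡v
      ... | inj₂ vx = contradiction (indA v∈A x∈) (true≢false vx)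

theorem1p8 : (d ℓ : ℕ) → 2 ≤ d → 2 ≤ ℓ → (n : ℕ) → (G : Graph (Fin (suc n)))
    → ¬ (S d InducedIn G) → ¬ (K ℓ InducedIn G)
    → ∃[ v ] αClosedNbhd< G v (d * d * ℓ + 2 * d * ℓ ^ (d ∸ 1))
theorem1p8 (suc e) ℓ 2≤d 2≤ℓ n G noS noK =
  let I , uI , indI , max = maximum-independent G
      -- A single vertex is independent, so the maximum independent set is nonempty.
      v , v∈I = nonempty I (max (zero ∷ []) ([] ∷ []) λ { (here refl) (here refl) → irrefl G zero })
  in  v , λ A inA → <-≤-trans
        (closed-neighbourhood-bound G refl (<⇒≤ 2≤ℓ) noS noK uI indI max v∈I A inA)
        -- The bound obtained has second term d ℓ^(d-1), at most the 2 d ℓ^(d-1) claimed.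
        (+-monoʳ-≤ (suc e * suc e * ℓ) (*-monoˡ-≤ (ℓ ^ e) (m≤m+n (suc e) _)))
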